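{- Let $A_n(x)$ denote the classical Eulerian polynomials. For every $n\geqslant 2$, the following two identities of $n\times n$ determinants hold: $$\frac{\mathrm{d}}{\mathrm{d}x} A_n(x)= \begin{vmatrix} 1 & -1 & 0 & \cdots & 0\\ \frac{\mathrm{d}}{\mathrm{d}x} A_1(x) & 2x & -1 & \cdots & 0\\ \frac{\mathrm{d}}{\mathrm{d}x} A_2(x) & 3x(1-x) & 3x & \cdots & 0\\ \vdots & \vdots & \vdots & \ddots & -1\\ \frac{\mathrm{d}}{\mathrm{d}x} A_{n-1}(x)& nx(1-x)^{n-2} & \binom n2x(1-x)^{n-3} & \cdots & nx \end{vmatrix},$$ $$\frac{\mathrm{d}}{\mathrm{d}x} A_{n-1}(x)= \begin{vmatrix} 1 & -1 & 0 & \cdots & 0\\ 1-2x & 2x & -1 & \cdots & 0\\ (1-x)(1-3x) & 3x(1-x) & 3x & \cdots & 0\\ \vdots & \vdots & \vdots & \ddots & -1\\ (1-x)^{n-2}(1-nx) & \binom n1 x(1-x)^{n-2} & \binom n2 x(1-x)^{n-3} &\cdots &\binom n{n-1}x \end{vmatrix}.$$ In both matrices, the $(i,j)$ entry for $2\leqslant j\leqslant i\leqslant n$ is $\binom{i}{j-1}x(1-x)^{i-j}$, the $(i,i+1)$ entries are $-1$, and the $(i,j)$ entries with $j>i+1$ are $0$. The $(1,1)$ entry is $1$ in both; for $2\leqslant i\leqslant n$ the $(i,1)$ entry is $\frac{\mathrm{d}}{\mathrm{d}x}A_{i-1}(x)$ in the first matrix and $(1-x)^{i-2}(1-ix)$ in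 the second.
   Context: The classical Eulerian polynomials $A_n(x)$ are defined by $A_0(x)=1$ and $A_n(x)=nxA_{n-1}(x)+x(1-x)\frac{\mathrm{d}}{\mathrm{d}x}A_{n-1}(x)$ for $n\geqslant 1$; thus $A_1(x)=x$, $A_2(x)=x+x^2$. Equivalently, $\sum_{n\geqslant 0}A_n(x)\frac{z^n}{n!}=\frac{1-x}{1-x\mathrm{e}^{(1-x)z}}$. -}

module Defs where

open import Algebra.Bundles.Raw using (RawRing)
import Algebra.Definitions.RawSemiring as RawSemiringDefinitions
open import Data.Bool.Base using (if_then_else_)
open import Data.Fin.Base using (Fin; zero; suc; toℕ; punchIn)
open import Data.Integer.Base as ℤ using (ℤ; 0ℤ; 1ℤ; +_)
open import Data.List.Base using (List; []; _∷_; map)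
open import Data.Nat.Base as ℕ using (ℕ; zero; suc; _∸_; _≤ᵇ_; _≡ᵇ_)
open import Data.Nat.Combinatorics using (_C_)
open import Level using (0ℓ)
open import Relation.Binary.PropositionalEquality using (_≡_)

module Determinant {c ℓ} (R : RawRing c ℓ) where
  open RawRing R
  open RawSemiringDefinitions rawSemiring using (_^_; sum)

  Matrix : ℕ → Set c
  Matrix n = Fin n → Fin n → Carrier

  minor : ∀ {n} → Fin (suc n) → Fin (suc n) → Matrix (suc n) → Matrix n
  minor i j M r s = M (punchIn i r) (punchIn j s)

  -- Laplace expansion along the first row.
  det : ∀ {n} → Matrix n → Carrier
  det {zero}  M = 1#
  det {suc n} M = sum λ j → (- 1#) ^ toℕ j * (M zero j * det (minor zero j M))

-- ℤ[x]: lists of coefficients, constant term first.  Trailing zeros are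
-- allowed, so equality of polynomials is `_≋_` rather than `_≡_`.
Poly : Set
Poly = List ℤ

coeff : Poly → ℕ → ℤ
coeff []      _       = 0ℤ
coeff (a ∷ _) zero    = a
coeff (_ ∷ p) (suc k) = coeff p k

infix 4 _≋_
record _≋_ (p q : Poly) : Set where
  constructor coeffwise
  field
    coeff-≡ : ∀ k → coeff p k ≡ coeff q k

addPoly : Poly → Poly → Poly
addPoly []      q       = q
addPoly (a ∷ p) []      = a ∷ p
addPoly (a ∷ p) (b ∷ q) = (a ℤ.+ b) ∷ addPoly p q

-- (a + x p) q = a q + x (p q)
mulPoly : Poly → Poly → Poly
mulPoly []      q = []
mulPoly (a ∷ p) q = addPoly (map (a ℤ.*_) q) (0ℤ ∷ mulPoly p q)

polyRawRing : RawRing 0ℓ 0ℓ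
polyRawRing = record
  { Carrier = Poly
  ; _≈_     = _≋_
  ; _+_     = addPoly
  ; _*_     = mulPoly
  ; -_      = map (ℤ.-_)
  ; 0#      = []
  ; 1#      = 1ℤ ∷ []
  }

open RawRing polyRawRing public
  using (_≈_; _+_; _*_; -_; 0#; 1#)
open RawSemiringDefinitions (RawRing.rawSemiring polyRawRing) public
  using (_^_)
  renaming (_×_ to _·_)
open Determinant polyRawRing public

x : Poly
x = 0ℤ ∷ 1ℤ ∷ []

-- scaleFrom m (a₀ ∷ a₁ ∷ …) = m a₀ ∷ (m + 1) a₁ ∷ …
scaleFrom : ℕ → Poly → Poly
scaleFrom m []      = []
scaleFrom m (a ∷ p) = (+ m) ℤ.* a ∷ scaleFrom (suc m) p

-- The formal derivative d/dx.
deriv : Poly → Poly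
deriv []      = []
deriv (_ ∷ p) = scaleFrom 1 p

-- The Eulerian polynomials; `n · p` is the natural-number multiple.
A : ℕ → Poly
A zero    = 1#
A (suc n) = suc n · x * A n + x * (1# + - x) * deriv (A n)

-- The (i , j) entry for j ≥ 2.
hessenbergEntry : ℕ → ℕ → Poly
hessenbergEntry i j =
  if j ≤ᵇ i then (i C (j ∸ 1)) · x * (1# + - x) ^ (i ∸ j)
  else if j ≡ᵇ suc i then - 1#
  else 0#

-- The entry functions use row and column numbers starting from 1, whereas
-- `Fin n` starts from 0.
hessenberg : (n : ℕ) → (ℕ → Poly) → Matrix n
hessenberg n firstColumn r zero      = firstColumn (suc (toℕ r))
hessenberg n firstColumn r c@(suc _) = hessenbergEntry (suc (toℕ r)) (suc (toℕ c))

-- The values at 0 of the next two functions are never used.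
firstColumn₁ : ℕ → Poly
firstColumn₁ 0       = 0#
firstColumn₁ 1       = 1#
firstColumn₁ (suc i) = deriv (A i)

firstColumn₂ : ℕ → Poly
firstColumn₂ 0 = 0#
firstColumn₂ 1 = 1#
firstColumn₂ i = (1# + - x) ^ (i ∸ 2) * (1# + - (i · x))

{-# OPTIONS --safe #-}

-- Write y = 1 - x and H n f = Σₖ C(n,k) yⁿ⁻ᵏ fₖ.  The recursion defining Aₙ
-- gives H (n+1) A = (n+1) Aₙ + y Aₙ′ by induction, hence Aₙ₊₁ = x H (n+1) A.
-- Differentiating, B = A′ satisfies Bₙ = y Bₙ₋₁ + x H n B for n ≥ 2, and the
-- shifted sequence 0, 1, B₁, B₂, … satisfies a similar recurrence.  Eliminating
-- the first row of a Hessenberg matrix with superdiagonal -1 leaves a matrix of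
-- the same kind, so its determinant is the last pivot D of the recurrence
-- Dᵢ = mᵢ₁ + Σⱼ mᵢⱼ Dⱼ₋₁.  For the two matrices above this recurrence,
-- multiplied by y, is the one for B, respectively for the shifted sequence.
module Submission where

open import Algebra.Bundles using (CommutativeRing)
open import Algebra.Bundles.Raw using (RawRing)
import Algebra.Definitions.RawSemiring as RawSemiringDefinitions
import Algebra.Solver.Ring.NaturalCoefficients.Default as SemiringSolver
open import Data.Fin.Base using (Fin; zero; suc; toℕ; punchIn)
open import Data.Integer.Base as ℤ using (ℤ; 0ℤ; 1ℤ; +_)
import Data.Integer.Properties as ℤ
open import Data.Integer.Tactic.RingSolver using (solve-∀)
open import Data.List.Base using ([]; _∷_; map)
open import Data.Nat.Base as ℕ using (ℕ; zero; suc; _∸_; _≤_; _<_; z≤n; s≤s)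
open import Data.Nat.Combinatorics using (_C_; nCk+nC[k+1]≡[n+1]C[k+1]; k>n⇒nCk≡0; nCn≡1)
import Data.Nat.Properties as ℕ
open import Data.Product.Base using (_×_; _,_)
open import Function.Base using (_∘_)
open import Level using (0ℓ)
open import Relation.Nullary.Decidable using (yes; no; dec-true; dec-false)
open import Relation.Binary.PropositionalEquality as ≡ using (_≡_; cong; cong₂)
open import Defs using (module Determinant)

-- Determinants of Hessenberg matrices with superdiagonal -1.

module HessenbergDeterminant {c ℓ} (R : CommutativeRing c ℓ) where
  open CommutativeRing R hiding (zero)
  open Determinant rawRing
  open RawSemiringDefinitions (RawRing.rawSemiring rawRing) using (_^_)
  open import Algebra.Properties.Ring ring using (-1*x≈-x; -‿involutive)
  open import Algebra.Properties.Monoid.Sum +-monoid using (sum; sum-cong-≋; sum-replicate-zero)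
  open import Relation.Binary.Reasoning.Setoid setoid
  open SemiringSolver commutativeSemiring using (solve; con; _:+_; _:*_; _:=_)

  sum-zero : ∀ {n} (t : Fin n → Carrier) → (∀ j → t j ≈ 0#) → sum t ≈ 0#
  sum-zero {n} t t≈0 = trans (sum-cong-≋ t≈0) (sum-replicate-zero n)

  det-cong : ∀ {n} (M N : Matrix n) → (∀ i j → M i j ≈ N i j) → det M ≈ det N
  det-cong {zero}  M N M≈N = refl
  det-cong {suc n} M N M≈N = sum-cong-≋ λ j →
    *-congˡ {x = (- 1#) ^ toℕ j} (*-cong (M≈N zero j)
      (det-cong (minor zero j M) (minor zero j N) λ r s → M≈N (suc r) (punchIn j s)))

  -- Rows are numbered from 0, and `e i j` is the entry in row i and column j + 1.
  hess : ∀ n → (ℕ → ℕ → Carrier) → (ℕ → Carrier) → Matrix n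
  hess n e a r zero    = a (toℕ r)
  hess n e a r (suc s) = e (toℕ r) (toℕ s)

  shift : (ℕ → ℕ → Carrier) → ℕ → ℕ → Carrier
  shift e i j = e (suc i) (suc j)

  record IsHessenberg (e : ℕ → ℕ → Carrier) : Set ℓ where
    field
      superdiagonal : ∀ i → e i i ≈ - 1#
      above         : ∀ {i j} → i < j → e i j ≈ 0#

  open IsHessenberg

  shift-isHessenberg : ∀ {e} → IsHessenberg e → IsHessenberg (shift e)
  shift-isHessenberg H .superdiagonal i = H .superdiagonal (suc i)
  shift-isHessenberg H .above i<j       = H .above (s≤s i<j)

  -- The first row vanishes beyond its first two entries, so the Laplace expansion has two terms.
  -- Deleting column 0 makes the old column 1 the first column; deleting column 1 keeps the tail of
  -- `a`, and there the cofactor sign cancels the entry -1.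
  hess-expand : ∀ {e} m (a : ℕ → Carrier) → IsHessenberg e →
    det (hess (2 ℕ.+ m) e a) ≈
    a 0 * det (hess (suc m) (shift e) (λ i → e (suc i) 0)) +
    det (hess (suc m) (shift e) (a ∘ suc))
  hess-expand {e} m a H = +-cong first (trans (+-cong second rest) (+-identityʳ _))
    where
    M = hess (2 ℕ.+ m) e a

    first : 1# * (a 0 * det (minor zero zero M)) ≈
            a 0 * det (hess (suc m) (shift e) (λ i → e (suc i) 0))
    first = trans (*-identityˡ _) (*-congˡ
      (det-cong (minor zero zero M) (hess (suc m) (shift e) (λ i → e (suc i) 0)) λ where
        r zero    → refl
        r (suc s) → refl))

    second : - 1# * 1# * (e 0 0 * det (minor zero (suc zero) M)) ≈
             det (hess (suc m) (shift e) (a ∘ suc))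
    second = begin
      - 1# * 1# * (e 0 0 * d)    ≈⟨ *-cong (*-identityʳ _) (*-congʳ (H .superdiagonal 0)) ⟩
      - 1# * (- 1# * d)          ≈⟨ trans (-1*x≈-x _) (-‿cong (-1*x≈-x d)) ⟩
      - - d                      ≈⟨ -‿involutive d ⟩
      d
        ≈⟨ det-cong (minor zero (suc zero) M) (hess (suc m) (shift e) (a ∘ suc)) (λ where
             r zero    → refl
             r (suc s) → refl) ⟩
      det (hess (suc m) (shift e) (a ∘ suc)) ∎
      where d = det (minor zero (suc zero) M)

    term : Fin (2 ℕ.+ m) → Carrier
    term j = (- 1#) ^ toℕ j * (M zero j * det (minor zero j M))

    rest : sum {m} (λ j → term (suc (suc j))) ≈ 0#
    rest = sum-zero (λ j → term (suc (suc j))) λ j → trans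
      (*-congˡ {x = (- 1#) ^ toℕ (suc (suc j))}
        (trans (*-congʳ (H .above (s≤s z≤n))) (zeroˡ (det (minor zero (suc (suc j)) M)))))
      (zeroʳ _)

  -- In `hess-expand` the cofactor `K` of the corner does not depend on the first column, and the
  -- other term is a smaller determinant of the same shape, so linearity in the first column follows
  -- by induction on the size.
  hess-linear : ∀ {e} m (a b : ℕ → Carrier) t → IsHessenberg e →
    det (hess (suc m) e (λ i → a i + t * b i)) ≈
    det (hess (suc m) e a) + t * det (hess (suc m) e b)
  hess-linear zero a b t H =
    solve 4 (λ one a b t → one :* ((a :+ t :* b) :* one) :+ con 0
                         := one :* (a :* one) :+ con 0 :+ t :* (one :* (b :* one) :+ con 0))
      refl 1# (a 0) (b 0) t
  hess-linear {e} (suc m) a b t H = begin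
    det (hess (2 ℕ.+ m) e (λ i → a i + t * b i))
      ≈⟨ hess-expand m (λ i → a i + t * b i) H ⟩
    (a 0 + t * b 0) * K + det (hess (suc m) (shift e) (λ i → a (suc i) + t * b (suc i)))
      ≈⟨ +-congˡ (hess-linear m (a ∘ suc) (b ∘ suc) t (shift-isHessenberg H)) ⟩
    (a 0 + t * b 0) * K + (dₐ + t * d_b)
      ≈⟨ solve 6 (λ a b t k da db → (a :+ t :* b) :* k :+ (da :+ t :* db)
                                 := a :* k :+ da :+ t :* (b :* k :+ db)) refl (a 0) (b 0) t K dₐ d_b ⟩
    a 0 * K + dₐ + t * (b 0 * K + d_b)
      ≈⟨ +-cong (hess-expand m a H) (*-congˡ (hess-expand m b H)) ⟨
    det (hess (2 ℕ.+ m) e a) + t * det (hess (2 ℕ.+ m) e b) ∎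
    where
    K   = det (hess (suc m) (shift e) (λ i → e (suc i) 0))
    dₐ  = det (hess (suc m) (shift e) (a ∘ suc))
    d_b = det (hess (suc m) (shift e) (b ∘ suc))

  -- The first column after s steps of eliminating the first row, if the
  -- pivots are D 0, …, D (s - 1).
  eliminated : (ℕ → ℕ → Carrier) → (a D : ℕ → Carrier) → ℕ → ℕ → Carrier
  eliminated e a D zero    i = a i
  eliminated e a D (suc s) i = eliminated e a D s i + D s * e i s

  -- By `hess-linear` the two terms of `hess-expand` merge into one smaller determinant, whose first
  -- column `a′` is the old one after one elimination step. Its pivots are `D 1`, `D 2`, ..., so the
  -- induction continues with `D ∘ suc`.
  hess-det : ∀ {e} m (a D : ℕ → Carrier) → IsHessenberg e →
    (∀ s → D s ≈ eliminated e a D s s) → det (hess (suc m) e a) ≈ D m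
  hess-det zero a D H pivots = begin
    1# * (a 0 * 1#) + 0#    ≈⟨ trans (+-identityʳ _) (*-identityˡ _) ⟩
    a 0 * 1#                ≈⟨ *-identityʳ _ ⟩
    a 0                     ≈⟨ pivots 0 ⟨
    D 0                     ∎
  hess-det {e} (suc m) a D H pivots = begin
    det (hess (2 ℕ.+ m) e a)
      ≈⟨ hess-expand m a H ⟩
    a 0 * _ + det (hess (suc m) (shift e) (a ∘ suc))
      ≈⟨ trans (+-comm _ _) (+-congˡ (*-congʳ (sym (pivots 0)))) ⟩
    det (hess (suc m) (shift e) (a ∘ suc)) + D 0 * _
      ≈⟨ hess-linear m (a ∘ suc) (λ i → e (suc i) 0) (D 0) (shift-isHessenberg H) ⟨
    det (hess (suc m) (shift e) a′)
      ≈⟨ hess-det m a′ (D ∘ suc) (shift-isHessenberg H)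
           (λ s → trans (pivots (suc s)) (sym (shifted s s))) ⟩
    D (suc m) ∎
    where
    a′ : ℕ → Carrier
    a′ i = a (suc i) + D 0 * e (suc i) 0

    shifted : ∀ s i → eliminated (shift e) a′ (D ∘ suc) s i ≈ eliminated e a D (suc s) (suc i)
    shifted zero    i = refl
    shifted (suc s) i = +-congʳ (shifted s i)

-- The binomial transform with weights y^(n-k).

module BinomialTransform {c ℓ} (R : CommutativeRing c ℓ) (y : CommutativeRing.Carrier R) where
  open CommutativeRing R hiding (zero)
  open RawSemiringDefinitions (RawRing.rawSemiring rawRing) using (_^_) renaming (_×_ to _·_)
  open import Algebra.Properties.Semiring.Mult semiring using (×-comm-*; ×-congˡ; ×-homo-+)
  open import Relation.Binary.Reasoning.Setoid setoid
  open SemiringSolver commutativeSemiring using (solve; con; _:+_; _:*_; _:=_)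

  -- The binomial transform Σₖ C(n,k) yⁿ⁻ᵏ fₖ, computed by Pascal's rule.
  transform : ℕ → (ℕ → Carrier) → Carrier
  transform zero    f = f 0
  transform (suc n) f = y * transform n f + transform n (f ∘ suc)

  -- The terms with k < m of the explicit binomial sum. For k > n the truncated exponent is
  -- harmless, since the binomial coefficient is zero.
  partialSum : ℕ → (ℕ → Carrier) → ℕ → Carrier
  partialSum n f zero    = 0#
  partialSum n f (suc m) = partialSum n f m + ((n C m) · (y ^ (n ∸ m))) * f m

  -- A factor `y` can be split off only if m < n; otherwise the truncated exponents coincide, but
  -- C(n,m+1) is zero.
  lower-power : ∀ n m → (n C suc m) · (y ^ (n ∸ m)) ≈ y * ((n C suc m) · (y ^ (n ∸ suc m)))
  lower-power n m with m ℕ.<? n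
  ... | yes m<n rewrite ℕ.+-∸-assoc 1 m<n = sym (×-comm-* (n C suc m) y (y ^ (n ∸ suc m)))
  ... | no  m≮n rewrite k>n⇒nCk≡0 (s≤s (ℕ.≮⇒≥ m≮n)) = sym (zeroʳ y)

  -- Pascal's rule splits the coefficient of f (k+1): the part C(n,k+1) gains a factor `y`, and the
  -- part C(n,k) goes to the shifted sum, which therefore has one term fewer.
  partialSum-pascal : ∀ n f m →
    partialSum (suc n) f (suc m) ≈ y * partialSum n f (suc m) + partialSum n (f ∘ suc) m
  partialSum-pascal n f zero =
    solve 3 (λ y u a → con 0 :+ (y :* u :+ con 0) :* a
                    := y :* (con 0 :+ (u :+ con 0) :* a) :+ con 0) refl y (y ^ n) (f 0)
  partialSum-pascal n f (suc m) = begin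
    partialSum (suc n) f (suc m) + ((suc n C suc m) · (y ^ (n ∸ m))) * f (suc m)
      ≈⟨ +-cong (partialSum-pascal n f m) (*-congʳ (begin
           (suc n C suc m) · (y ^ (n ∸ m))
             ≈⟨ ×-congˡ (≡.sym (nCk+nC[k+1]≡[n+1]C[k+1] n m)) ⟩
           (n C m ℕ.+ n C suc m) · (y ^ (n ∸ m))
             ≈⟨ ×-homo-+ (y ^ (n ∸ m)) (n C m) (n C suc m) ⟩
           (n C m) · (y ^ (n ∸ m)) + (n C suc m) · (y ^ (n ∸ m))
             ≈⟨ +-congˡ (lower-power n m) ⟩
           (n C m) · (y ^ (n ∸ m)) + y * ((n C suc m) · (y ^ (n ∸ suc m))) ∎)) ⟩
    (y * partialSum n f (suc m) + partialSum n (f ∘ suc) m)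
      + ((n C m) · (y ^ (n ∸ m)) + y * ((n C suc m) · (y ^ (n ∸ suc m)))) * f (suc m)
      ≈⟨ solve 6 (λ y p q u v a → (y :* p :+ q) :+ (u :+ y :* v) :* a
                               := y :* (p :+ v :* a) :+ (q :+ u :* a))
           refl y (partialSum n f (suc m)) (partialSum n (f ∘ suc) m)
           ((n C m) · (y ^ (n ∸ m))) ((n C suc m) · (y ^ (n ∸ suc m))) (f (suc m)) ⟩
    y * partialSum n f (suc (suc m)) + partialSum n (f ∘ suc) (suc m) ∎

  partialSum≈transform : ∀ n f → partialSum n f (suc n) ≈ transform n f
  partialSum≈transform zero    f = solve 1 (λ a → con 0 :+ (con 1 :+ con 0) :* a := a) refl (f 0)
  partialSum≈transform (suc n) f = begin
    partialSum (suc n) f (suc (suc n))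
      ≈⟨ partialSum-pascal n f (suc n) ⟩
    y * (partialSum n f (suc n) + ((n C suc n) · (y ^ (n ∸ suc n))) * f (suc n))
      + partialSum n (f ∘ suc) (suc n)
      -- The first sum runs one term too far, to k = n + 1, where the binomial coefficient of row n
      -- vanishes.
      ≈⟨ +-congʳ (*-congˡ (trans (+-congˡ (trans
           (*-congʳ (×-congˡ (k>n⇒nCk≡0 (ℕ.n<1+n n)))) (zeroˡ (f (suc n))))) (+-identityʳ _))) ⟩
    y * partialSum n f (suc n) + partialSum n (f ∘ suc) (suc n)
      ≈⟨ +-cong (*-congˡ (partialSum≈transform n f)) (partialSum≈transform n (f ∘ suc)) ⟩
    transform (suc n) f ∎

-- Pivots of a Hessenberg matrix with binomial entries.

module PivotElimination {c ℓ} (R : CommutativeRing c ℓ) where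
  open CommutativeRing R hiding (zero)
  open RawSemiringDefinitions (RawRing.rawSemiring rawRing) using (_^_) renaming (_×_ to _·_)
  open import Algebra.Properties.Group +-group using () renaming (∙-cancelʳ to +-cancelʳ)
  open import Algebra.Properties.Semiring.Mult semiring using (×-assoc-*; ×-comm-*)
  open import Relation.Binary.Reasoning.Setoid setoid
  open SemiringSolver commutativeSemiring using (solve; _:*_; _:=_)
  open Determinant rawRing using (det)
  open HessenbergDeterminant R

  module ByTransform (x y : Carrier)
    (x+y≈1 : x + y ≈ 1#) (y-cancelˡ : ∀ a b → y * a ≈ y * b → a ≈ b) where
    open BinomialTransform R y

    module _ {e : ℕ → ℕ → Carrier} {a D : ℕ → Carrier}
      (e-below : ∀ {i j} → j < i → e i j ≈ ((suc i C suc j) · x) * y ^ (i ∸ suc j))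
      (D0≈0 : D 0 ≈ 0#) where

      -- The pivot of row s is `D (suc s)`. Multiplying an entry by `y` raises its exponent to the
      -- one in the binomial transform, so elimination accumulates `x` times the terms from k = 1
      -- on; the term k = 0 is zero because `D 0` is.
      eliminated-partialSum : ∀ s i → s ≤ i →
        y * eliminated e a (D ∘ suc) s i ≈ y * a i + x * partialSum (suc i) D (suc s)
      eliminated-partialSum zero i _ = sym (begin
        y * a i + x * (0# + _ * D 0)   ≈⟨ +-congˡ (*-congˡ (trans (+-identityˡ _) (*-congˡ D0≈0))) ⟩
        y * a i + x * (_ * 0#)         ≈⟨ +-congˡ (trans (*-congˡ (zeroʳ _)) (zeroʳ x)) ⟩
        y * a i + 0#                   ≈⟨ +-identityʳ (y * a i) ⟩
        y * a i                        ∎)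
      eliminated-partialSum (suc s) i s<i = begin
        y * (eliminated e a (D ∘ suc) s i + D (suc s) * e i s)
          ≈⟨ distribˡ y _ _ ⟩
        y * eliminated e a (D ∘ suc) s i + y * (D (suc s) * e i s)
          ≈⟨ +-cong (eliminated-partialSum s i (ℕ.<⇒≤ s<i)) entry ⟩
        (y * a i + x * partialSum (suc i) D (suc s)) + x * (binomial * D (suc s))
          ≈⟨ trans (+-assoc _ _ _) (+-congˡ (sym (distribˡ x _ _))) ⟩
        y * a i + x * partialSum (suc i) D (suc (suc s)) ∎
        where
        C′ = suc i C suc s
        binomial = C′ · (y ^ (i ∸ s))

        entry : y * (D (suc s) * e i s) ≈ x * (binomial * D (suc s))
        entry = begin
          y * (D (suc s) * e i s)
            ≈⟨ *-congˡ (*-congˡ (trans (e-below s<i) (×-assoc-* C′ x _))) ⟩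
          y * (D (suc s) * (C′ · (x * y ^ (i ∸ suc s))))
            ≈⟨ *-congˡ (*-congˡ (×-comm-* C′ x _)) ⟨
          y * (D (suc s) * (x * (C′ · (y ^ (i ∸ suc s)))))
            ≈⟨ solve 4 (λ y d x u → y :* (d :* (x :* u)) := x :* (y :* u :* d)) refl y _ x _ ⟩
          x * (y * (C′ · (y ^ (i ∸ suc s))) * D (suc s))
            ≈⟨ *-congˡ (*-congʳ (×-comm-* C′ y _)) ⟩
          x * (C′ · (y ^ suc (i ∸ suc s)) * D (suc s))
            ≡⟨ cong (λ k → x * (C′ · (y ^ k) * D (suc s))) (≡.sym (ℕ.+-∸-assoc 1 s<i)) ⟩
          x * (binomial * D (suc s)) ∎

      -- The recurrence for D is used in the form where the pivot
      -- D (suc i) = (x + y) D (suc i) appears on both sides with coefficient x.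
      hess-det-transform :
        IsHessenberg e → (∀ i → D (suc i) ≈ y * a i + x * transform (suc i) D) →
        ∀ m → det (hess (suc m) e a) ≈ D (suc m)
      hess-det-transform H recurrence m = hess-det m a (D ∘ suc) H pivot
        where
        pivot : ∀ s → D (suc s) ≈ eliminated e a (D ∘ suc) s s
        pivot s = y-cancelˡ _ _ (+-cancelʳ (x * D (suc s)) _ _ (begin
          y * D (suc s) + x * D (suc s)
            ≈⟨ trans (sym (distribʳ _ y x)) (trans (*-congʳ (trans (+-comm y x) x+y≈1)) (*-identityˡ _)) ⟩
          D (suc s)
            ≈⟨ recurrence s ⟩
          y * a s + x * transform (suc s) D
            ≈⟨ +-congˡ (*-congˡ (partialSum≈transform (suc s) D)) ⟨
          y * a s + x * (partialSum (suc s) D (suc s) + ((suc s C suc s) · (y ^ (s ∸ s))) * D (suc s))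
            -- The top term k = s + 1 of the transform has coefficient 1: it is the pivot itself.
            ≈⟨ +-congˡ (*-congˡ (+-congˡ (trans (*-congʳ top) (*-identityˡ _)))) ⟩
          y * a s + x * (partialSum (suc s) D (suc s) + D (suc s))
            ≈⟨ trans (+-congˡ (distribˡ x _ _)) (sym (+-assoc _ _ _)) ⟩
          y * a s + x * partialSum (suc s) D (suc s) + x * D (suc s)
            ≈⟨ +-congʳ (eliminated-partialSum s s ℕ.≤-refl) ⟨
          y * eliminated e a (D ∘ suc) s s + x * D (suc s) ∎))
          where
          top : (suc s C suc s) · (y ^ (s ∸ s)) ≈ 1#
          top rewrite nCn≡1 (suc s) | ℕ.n∸n≡0 s = +-identityʳ 1#

-- Recurrences for Eulerian polynomials and their derivatives.

module EulerianRecurrences {c ℓ} (R : CommutativeRing c ℓ) where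
  open CommutativeRing R hiding (zero)
  open RawSemiringDefinitions (RawRing.rawSemiring rawRing) using (_^_) renaming (_×_ to _·_)
  open import Algebra.Properties.Group +-group using () renaming (∙-cancelʳ to +-cancelʳ)
  open import Algebra.Properties.Semiring.Mult semiring using (×-assoc-*; ×-congʳ)
  open import Relation.Binary.Reasoning.Setoid setoid
  open SemiringSolver commutativeSemiring using (solve; con; _:+_; _:*_; _:=_)

  module FromDerivation (x y : Carrier)
    (x+y≈1 : x + y ≈ 1#)
    (δ : Carrier → Carrier)
    (δ-cong : ∀ {a b} → a ≈ b → δ a ≈ δ b)
    -- Of the Leibniz rule only multiplication by `x` and `y` is required. Since δ y = -1, the law
    -- for `y` is written with the negative term moved to the left, which keeps the later
    -- rearrangements within semiring identities.
    (δ-+ : ∀ a b → δ (a + b) ≈ δ a + δ b)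
    (δ-x* : ∀ a → δ (x * a) ≈ a + x * δ a)
    (δ-y* : ∀ a → δ (y * a) + a ≈ y * δ a)
    (A : ℕ → Carrier)
    (A-zero : A 0 ≈ 1#)
    (δA-zero : δ (A 0) ≈ 0#)
    (A-suc : ∀ n → A (suc n) ≈ (suc n · x) * A n + x * y * δ (A n))
    where
    open BinomialTransform R y

    ν : ℕ → Carrier
    ν n = n · 1#

    ν-* : ∀ n a → n · a ≈ ν n * a
    ν-* n a = sym (trans (×-assoc-* n 1# a) (×-congʳ n (*-identityˡ a)))

    δ-step : ∀ a b → δ (y * a + b) + a ≈ y * δ a + δ b
    δ-step a b = begin
      δ (y * a + b) + a        ≈⟨ +-congʳ (δ-+ (y * a) b) ⟩
      δ (y * a) + δ b + a      ≈⟨ solve 3 (λ u v a → u :+ v :+ a := (u :+ a) :+ v) refl (δ (y * a)) (δ b) a ⟩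
      (δ (y * a) + a) + δ b    ≈⟨ +-congʳ (δ-y* a) ⟩
      y * δ a + δ b            ∎

    -- The operator κ + x y δ, which raises the index of f, also raises that of its transform.
    -- Differentiating the factor `y` in `y * P` costs x y P, and this is what the increment `x` of
    -- `κ` repays.
    transform-raise : ∀ f (κ : ℕ → Carrier) → (∀ k → κ (suc k) ≈ x + κ k) →
      (∀ k → κ k * f k + x * y * δ (f k) ≈ f (suc k)) →
      ∀ n → κ n * transform n f + x * y * δ (transform n f) ≈ transform n (f ∘ suc)
    transform-raise f κ κ-suc raise zero    = raise 0
    transform-raise f κ κ-suc raise (suc n) = begin
      κ (suc n) * (y * P + Q) + x * y * δ (y * P + Q)
        ≈⟨ solve 6 (λ k x y P Q d → k :* (y :* P :+ Q) :+ x :* y :* d := k :* (y :* P) :+ (k :* Q :+ x :* y :* d))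
             refl (κ (suc n)) x y P Q (δ (y * P + Q)) ⟩
      κ (suc n) * (y * P) + (κ (suc n) * Q + x * y * δ (y * P + Q))
        ≈⟨ +-congʳ (*-congʳ (κ-suc n)) ⟩
      (x + κ n) * (y * P) + (κ (suc n) * Q + x * y * δ (y * P + Q))
        ≈⟨ solve 7 (λ k l x y P Q d → (x :+ l) :* (y :* P) :+ (k :* Q :+ x :* y :* d)
                                   := l :* (y :* P) :+ k :* Q :+ x :* y :* (d :+ P))
             refl (κ (suc n)) (κ n) x y P Q (δ (y * P + Q)) ⟩
      κ n * (y * P) + κ (suc n) * Q + x * y * (δ (y * P + Q) + P)
        ≈⟨ +-congˡ (*-congˡ (δ-step P Q)) ⟩
      κ n * (y * P) + κ (suc n) * Q + x * y * (y * δ P + δ Q)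
        ≈⟨ solve 8 (λ k l x y P Q p q → l :* (y :* P) :+ k :* Q :+ x :* y :* (y :* p :+ q)
                                     := y :* (l :* P :+ x :* y :* p) :+ (k :* Q :+ x :* y :* q))
             refl (κ (suc n)) (κ n) x y P Q (δ P) (δ Q) ⟩
      y * (κ n * P + x * y * δ P) + (κ (suc n) * Q + x * y * δ Q)
        ≈⟨ +-cong (*-congˡ (transform-raise f κ κ-suc raise n))
             (transform-raise (f ∘ suc) (κ ∘ suc) (λ k → κ-suc (suc k)) (λ k → raise (suc k)) n) ⟩
      y * transform n (f ∘ suc) + transform n (λ k → f (suc (suc k))) ∎
      where
      P = transform n f
      Q = transform n (f ∘ suc)

    -- Differentiating the weights gives -(n+1-k) y^(n-k), and (n+1-k) C(n+1,k) = (n+1) C(n,k); this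
    -- accounts for the correction term. The proof obtains it by induction through the Pascal
    -- recursion.
    transform-δ : ∀ n f → δ (transform (suc n) f) + ν (suc n) * transform n f ≈ transform (suc n) (δ ∘ f)
    transform-δ zero    f = trans
      (+-congˡ (trans (*-congʳ (+-identityʳ 1#)) (*-identityˡ (f 0))))
      (δ-step (f 0) (f 1))
    transform-δ (suc n) f = begin
      δ (y * P + Q) + (1# + ν (suc n)) * P
        ≈⟨ solve 3 (λ d k P → d :+ (con 1 :+ k) :* P := (d :+ P) :+ k :* P) refl (δ (y * P + Q)) (ν (suc n)) P ⟩
      (δ (y * P + Q) + P) + ν (suc n) * P
        ≈⟨ +-congʳ (δ-step P Q) ⟩
      (y * δ P + δ Q) + ν (suc n) * (y * P′ + Q′)
        ≈⟨ solve 6 (λ y p q k u v → (y :* p :+ q) :+ k :* (y :* u :+ v) := y :* (p :+ k :* u) :+ (q :+ k :* v))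
             refl y (δ P) (δ Q) (ν (suc n)) P′ Q′ ⟩
      y * (δ P + ν (suc n) * P′) + (δ Q + ν (suc n) * Q′)
        ≈⟨ +-cong (*-congˡ (transform-δ n f)) (transform-δ n (f ∘ suc)) ⟩
      transform (suc (suc n)) (δ ∘ f) ∎
      where
      P  = transform (suc n) f
      Q  = transform (suc n) (f ∘ suc)
      P′ = transform n f
      Q′ = transform n (f ∘ suc)

    factor-x : ∀ n a b → (n · x) * a + x * y * b ≈ x * (ν n * a + y * b)
    factor-x n a b = trans (+-congʳ (*-congʳ (ν-* n x)))
      (solve 5 (λ k x y a b → k :* x :* a :+ x :* y :* b := x :* (k :* a :+ y :* b)) refl (ν n) x y a b)

    mutual
      A≈x*transform : ∀ n → A (suc n) ≈ x * transform (suc n) A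
      A≈x*transform n = begin
        A (suc n)                                ≈⟨ A-suc n ⟩
        (suc n · x) * A n + x * y * δ (A n)      ≈⟨ factor-x (suc n) (A n) (δ (A n)) ⟩
        x * (ν (suc n) * A n + y * δ (A n))      ≈⟨ *-congˡ (transform-A n) ⟨
        x * transform (suc n) A                  ∎

      -- With κ k = (k+1) x the hypothesis of `transform-raise` is the recursion for `A`, which
      -- evaluates the shifted transform in the induction step.
      transform-A : ∀ n → transform (suc n) A ≈ ν (suc n) * A n + y * δ (A n)
      transform-A zero = begin
        y * A 0 + A 1
          ≈⟨ +-congˡ (A-suc 0) ⟩
        y * A 0 + ((x + 0#) * A 0 + x * y * δ (A 0))
          ≈⟨ solve 4 (λ x y a b → y :* a :+ ((x :+ con 0) :* a :+ x :* y :* b)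
                               := (x :+ y) :* a :+ x :* y :* b) refl x y (A 0) (δ (A 0)) ⟩
        (x + y) * A 0 + x * y * δ (A 0)
          ≈⟨ +-cong (*-congʳ (trans x+y≈1 (sym (+-identityʳ 1#)))) (trans (*-congˡ δA-zero) (zeroʳ _)) ⟩
        (1# + 0#) * A 0 + 0#
          ≈⟨ +-congˡ (trans (*-congˡ δA-zero) (zeroʳ y)) ⟨
        (1# + 0#) * A 0 + y * δ (A 0) ∎
      transform-A (suc n) = begin
        y * G + transform (suc n) (A ∘ suc)
          ≈⟨ +-congˡ (transform-raise A (λ k → suc k · x) (λ k → refl) (λ k → sym (A-suc k)) (suc n)) ⟨
        y * G + ((suc (suc n) · x) * G + x * y * δ G)
          ≈⟨ +-congˡ (factor-x (suc (suc n)) G (δ G)) ⟩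
        y * G + x * (ν (suc (suc n)) * G + y * δ G)
          -- Regrouped so that `G` enters only through `x * G` and its derivative, where `x * G` is
          -- `A (suc n)` by the previous stage of the mutual induction.
          ≈⟨ solve 5 (λ x y k g d → y :* g :+ x :* (k :* g :+ y :* d) := k :* (x :* g) :+ y :* (g :+ x :* d))
               refl x y (ν (suc (suc n))) G (δ G) ⟩
        ν (suc (suc n)) * (x * G) + y * (G + x * δ G)
          ≈⟨ +-congˡ (*-congˡ (δ-x* G)) ⟨
        ν (suc (suc n)) * (x * G) + y * δ (x * G)
          ≈⟨ +-cong (*-congˡ (A≈x*transform n)) (*-congˡ (δ-cong (A≈x*transform n))) ⟨
        ν (suc (suc n)) * A (suc n) + y * δ (A (suc n)) ∎
        where G = transform (suc n) A

    -- Differentiating `x * G` gives `G + x * δ G`. Rewriting the first `G` by `transform-A` yields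
    -- `y * δ (A (suc n))` and the correction term that `transform-δ` absorbs.
    δA-recurrence : ∀ n → δ (A (2 ℕ.+ n)) ≈ y * δ (A (1 ℕ.+ n)) + x * transform (2 ℕ.+ n) (δ ∘ A)
    δA-recurrence n = begin
      δ (A (2 ℕ.+ n))
        ≈⟨ δ-cong (A≈x*transform (suc n)) ⟩
      δ (x * G)
        ≈⟨ δ-x* G ⟩
      G + x * δ G
        ≈⟨ +-congʳ (trans (transform-A (suc n)) (+-congʳ (*-congˡ (A≈x*transform n)))) ⟩
      (ν (2 ℕ.+ n) * (x * transform (suc n) A) + y * δ (A (suc n))) + x * δ G
        ≈⟨ solve 5 (λ x k g b d → (k :* (x :* g) :+ b) :+ x :* d := b :+ x :* (d :+ k :* g))
             refl x (ν (2 ℕ.+ n)) (transform (suc n) A) (y * δ (A (suc n))) (δ G) ⟩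
      y * δ (A (suc n)) + x * (δ G + ν (2 ℕ.+ n) * transform (suc n) A)
        ≈⟨ +-congˡ (*-congˡ (transform-δ (suc n) A)) ⟩
      y * δ (A (suc n)) + x * transform (2 ℕ.+ n) (δ ∘ A) ∎
      where G = transform (2 ℕ.+ n) A

    δA-one : δ (A 1) ≈ 1#
    δA-one = begin
      δ (A 1)          ≈⟨ δ-cong (trans (A≈x*transform 0) (*-congˡ G≈A0)) ⟩
      δ (x * A 0)      ≈⟨ δ-x* (A 0) ⟩
      A 0 + x * δ (A 0) ≈⟨ +-cong A-zero (trans (*-congˡ δA-zero) (zeroʳ x)) ⟩
      1# + 0#          ≈⟨ +-identityʳ 1# ⟩
      1#               ∎
      where
      G≈A0 : transform 1 A ≈ A 0
      G≈A0 = begin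
        transform 1 A                  ≈⟨ transform-A 0 ⟩
        (1# + 0#) * A 0 + y * δ (A 0)  ≈⟨ +-cong (*-congʳ (+-identityʳ 1#)) (trans (*-congˡ δA-zero) (zeroʳ y)) ⟩
        1# * A 0 + 0#                  ≈⟨ trans (+-identityʳ _) (*-identityˡ (A 0)) ⟩
        A 0                            ∎

    column₁ : ℕ → Carrier
    column₁ zero    = 1#
    column₁ (suc i) = δ (A (suc i))

    δA-pivots : ∀ i → δ (A (suc i)) ≈ y * column₁ i + x * transform (suc i) (δ ∘ A)
    -- The corner entry is 1 and not δ (A 0) = 0, so the first pivot is computed separately.
    δA-pivots zero = sym (begin
      y * 1# + x * (y * δ (A 0) + δ (A 1))  ≈⟨ +-congˡ (*-congˡ (+-cong (*-congˡ δA-zero) δA-one)) ⟩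
      y * 1# + x * (y * 0# + 1#)            ≈⟨ solve 2 (λ x y → y :* con 1 :+ x :* (y :* con 0 :+ con 1) := x :+ y) refl x y ⟩
      x + y                                 ≈⟨ x+y≈1 ⟩
      1#                                    ≈⟨ δA-one ⟨
      δ (A 1)                               ∎)
    δA-pivots (suc i) = δA-recurrence i

    δA⁻ : ℕ → Carrier
    δA⁻ 0             = 0#
    δA⁻ 1             = 1#
    δA⁻ (suc (suc n)) = δ (A (suc n))

    -- The two sequences differ only at index 0, where the values are 1 and 0; the weight of that
    -- index is y^n.
    transform-δA⁻∘suc : ∀ n → transform n (δA⁻ ∘ suc) ≈ y ^ n + transform n (δ ∘ A)
    transform-δA⁻∘suc zero    = sym (trans (+-congˡ δA-zero) (+-identityʳ 1#))
    transform-δA⁻∘suc (suc n) = trans (+-congʳ (*-congˡ (transform-δA⁻∘suc n)))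
      (solve 4 (λ y w p q → y :* (w :+ p) :+ q := y :* w :+ (y :* p :+ q))
        refl y (y ^ n) (transform n (δ ∘ A)) (transform n (δ ∘ A ∘ suc)))

    -- The pivot recurrence for the second column, with the negative part of `y * column₂ (suc n)`
    -- moved to the left. The step expands by `δA-recurrence`; `y` times the induction hypothesis
    -- and the shifted transform then reassemble the next transform.
    δA⁻-recurrence : ∀ n →
      δA⁻ (2 ℕ.+ n) + ν (2 ℕ.+ n) * (x * y ^ suc n) ≈ y ^ suc n + x * transform (2 ℕ.+ n) δA⁻
    δA⁻-recurrence zero = begin
      δ (A 1) + (1# + (1# + 0#)) * (x * (y * 1#))
        ≈⟨ +-congʳ (trans δA-one (sym x+y≈1)) ⟩
      (x + y) + (1# + (1# + 0#)) * (x * (y * 1#))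
        ≈⟨ solve 2 (λ x y → (x :+ y) :+ (con 1 :+ (con 1 :+ con 0)) :* (x :* (y :* con 1))
                         := y :* con 1 :+ x :* (y :* (y :* con 0 :+ con 1) :+ (y :* con 1 :+ con 1))) refl x y ⟩
      y * 1# + x * (y * (y * 0# + 1#) + (y * 1# + 1#))
        ≈⟨ +-congˡ (*-congˡ (+-congˡ (+-congˡ δA-one))) ⟨
      y * 1# + x * (y * (y * 0# + 1#) + (y * 1# + δ (A 1))) ∎
    δA⁻-recurrence (suc n) = begin
      δ (A (2 ℕ.+ n)) + (1# + ν (2 ℕ.+ n)) * (x * (y * w))
        ≈⟨ +-congʳ (δA-recurrence n) ⟩
      (y * δ (A (1 ℕ.+ n)) + x * H) + (1# + ν (2 ℕ.+ n)) * (x * (y * w))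
        ≈⟨ solve 6 (λ x y b h k w → (y :* b :+ x :* h) :+ (con 1 :+ k) :* (x :* (y :* w))
                                 := y :* (b :+ k :* (x :* w)) :+ x :* (y :* w :+ h))
             refl x y (δ (A (1 ℕ.+ n))) H (ν (2 ℕ.+ n)) w ⟩
      y * (δ (A (1 ℕ.+ n)) + ν (2 ℕ.+ n) * (x * w)) + x * (y * w + H)
        ≈⟨ +-cong (*-congˡ (δA⁻-recurrence n)) (*-congˡ (sym (transform-δA⁻∘suc (2 ℕ.+ n)))) ⟩
      y * (w + x * K) + x * transform (2 ℕ.+ n) (δA⁻ ∘ suc)
        ≈⟨ solve 5 (λ x y w k l → y :* (w :+ x :* k) :+ x :* l := y :* w :+ x :* (y :* k :+ l))
             refl x y w K (transform (2 ℕ.+ n) (δA⁻ ∘ suc)) ⟩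
      y * w + x * transform (3 ℕ.+ n) δA⁻ ∎
      where
      w = y ^ suc n
      H = transform (2 ℕ.+ n) (δ ∘ A)
      K = transform (2 ℕ.+ n) δA⁻

    column₂ : ℕ → Carrier
    column₂ zero    = 1#
    column₂ (suc i) = y ^ i * (1# + - ((2 ℕ.+ i) · x))

    δA⁻-pivots : ∀ i → δA⁻ (suc i) ≈ y * column₂ i + x * transform (suc i) δA⁻
    δA⁻-pivots zero = sym (begin
      y * 1# + x * (y * 0# + 1#)  ≈⟨ solve 2 (λ x y → y :* con 1 :+ x :* (y :* con 0 :+ con 1) := x :+ y) refl x y ⟩
      x + y                       ≈⟨ x+y≈1 ⟩
      1#                          ∎)
    δA⁻-pivots (suc i) = +-cancelʳ (N * (x * (y * w))) _ _ (begin
      δ (A (suc i)) + N * (x * (y * w))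
        ≈⟨ δA⁻-recurrence i ⟩
      y * w + x * T
        ≈⟨ +-congʳ (trans (+-congˡ (trans (*-congˡ (-‿inverseˡ N*x)) (zeroʳ (y * w)))) (+-identityʳ (y * w))) ⟨
      (y * w + y * w * (- N*x + N*x)) + x * T
        ≈⟨ solve 6 (λ y w m p t x → (y :* w :+ y :* w :* (m :+ p)) :+ x :* t
                                 := (y :* (w :* (con 1 :+ m)) :+ x :* t) :+ y :* w :* p)
             refl y w (- N*x) N*x T x ⟩
      (y * (w * (1# + - N*x)) + x * T) + y * w * N*x
        ≈⟨ +-congˡ (trans (*-congˡ (ν-* (2 ℕ.+ i) x))
             (solve 4 (λ y w n x → y :* w :* (n :* x) := n :* (x :* (y :* w))) refl y w N x)) ⟩
      (y * (w * (1# + - N*x)) + x * T) + N * (x * (y * w)) ∎)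
      where
      N   = ν (2 ℕ.+ i)
      N*x = (2 ℕ.+ i) · x
      w   = y ^ i
      T   = transform (2 ℕ.+ i) δA⁻

-- The commutative ring of integer polynomials.

open import Defs

private
  Seq : Set
  Seq = ℕ → ℤ

  variable
    p q : Poly

-- The Cauchy product.  The ring laws are proved for coefficient sequences,
-- where trailing zeros cause no case distinctions.
infixl 7 _⋆_
_⋆_ : Seq → Seq → Seq
(f ⋆ g) zero    = f 0 ℤ.* g 0
(f ⋆ g) (suc k) = f 0 ℤ.* g (suc k) ℤ.+ (f ∘ suc ⋆ g) k

⋆-cong : ∀ {f f′ g g′} → (∀ k → f k ≡ f′ k) → (∀ k → g k ≡ g′ k) → ∀ k → (f ⋆ g) k ≡ (f′ ⋆ g′) k
⋆-cong f≗ g≗ zero    = cong₂ ℤ._*_ (f≗ 0) (g≗ 0)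
⋆-cong f≗ g≗ (suc k) =
  cong₂ ℤ._+_ (cong₂ ℤ._*_ (f≗ 0) (g≗ (suc k))) (⋆-cong (f≗ ∘ suc) g≗ k)

⋆-zeroˡ : ∀ g k → ((λ _ → 0ℤ) ⋆ g) k ≡ 0ℤ
⋆-zeroˡ g zero    = ≡.refl
⋆-zeroˡ g (suc k) = ≡.trans (ℤ.+-identityˡ _) (⋆-zeroˡ g k)

-- The defining recursion peels the left factor; this mirror image peels the right one, which is
-- what commutativity needs.
⋆-sucʳ : ∀ f g k → (f ⋆ g) (suc k) ≡ f (suc k) ℤ.* g 0 ℤ.+ (f ⋆ g ∘ suc) k
⋆-sucʳ f g zero    = ℤ.+-comm (f 0 ℤ.* g 1) (f 1 ℤ.* g 0)
⋆-sucʳ f g (suc k) = ≡.trans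
  (cong (λ u → f 0 ℤ.* g (2 ℕ.+ k) ℤ.+ u) (⋆-sucʳ (f ∘ suc) g k))
  (swap (f 0 ℤ.* g (2 ℕ.+ k)) (f (2 ℕ.+ k) ℤ.* g 0) _)
  where
  swap : ∀ a b c → a ℤ.+ (b ℤ.+ c) ≡ b ℤ.+ (a ℤ.+ c)
  swap = solve-∀

⋆-comm : ∀ f g k → (f ⋆ g) k ≡ (g ⋆ f) k
⋆-comm f g zero    = ℤ.*-comm (f 0) (g 0)
⋆-comm f g (suc k) = ≡.trans
  (cong₂ ℤ._+_ (ℤ.*-comm (f 0) (g (suc k))) (⋆-comm (f ∘ suc) g k))
  (≡.sym (⋆-sucʳ g f k))

⋆-distribʳ : ∀ f g h k → ((λ i → f i ℤ.+ g i) ⋆ h) k ≡ (f ⋆ h) k ℤ.+ (g ⋆ h) k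
⋆-distribʳ f g h zero    = ℤ.*-distribʳ-+ (h 0) (f 0) (g 0)
⋆-distribʳ f g h (suc k) = ≡.trans
  (cong (λ u → (f 0 ℤ.+ g 0) ℤ.* h (suc k) ℤ.+ u) (⋆-distribʳ (f ∘ suc) (g ∘ suc) h k))
  (expand (f 0) (g 0) (h (suc k)) _ _)
  where
  expand : ∀ a b c u v →
    (a ℤ.+ b) ℤ.* c ℤ.+ (u ℤ.+ v) ≡ (a ℤ.* c ℤ.+ u) ℤ.+ (b ℤ.* c ℤ.+ v)
  expand = solve-∀

⋆-scaleˡ : ∀ a f g k → ((λ i → a ℤ.* f i) ⋆ g) k ≡ a ℤ.* (f ⋆ g) k
⋆-scaleˡ a f g zero    = ℤ.*-assoc a (f 0) (g 0)
⋆-scaleˡ a f g (suc k) = ≡.trans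
  (cong₂ ℤ._+_ (ℤ.*-assoc a (f 0) (g (suc k))) (⋆-scaleˡ a (f ∘ suc) g k))
  (≡.sym (ℤ.*-distribˡ-+ a (f 0 ℤ.* g (suc k)) _))

-- The tail of `f ⋆ g` is `f 0` times the tail of `g`, plus `f ∘ suc ⋆ g`; distributivity and
-- scaling reduce the claim to `f ∘ suc`.
⋆-assoc : ∀ f g h k → ((f ⋆ g) ⋆ h) k ≡ (f ⋆ (g ⋆ h)) k
⋆-assoc f g h zero    = ℤ.*-assoc (f 0) (g 0) (h 0)
⋆-assoc f g h (suc k) = ≡.trans
  (cong (λ u → f 0 ℤ.* g 0 ℤ.* h (suc k) ℤ.+ u) (≡.trans
    (⋆-distribʳ (λ i → f 0 ℤ.* g (suc i)) (f ∘ suc ⋆ g) h k)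
    (cong₂ ℤ._+_ (⋆-scaleˡ (f 0) (g ∘ suc) h k) (⋆-assoc (f ∘ suc) g h k))))
  (collect (f 0) (g 0) (h (suc k)) _ _)
  where
  collect : ∀ a b c u v →
    a ℤ.* b ℤ.* c ℤ.+ (a ℤ.* u ℤ.+ v) ≡ a ℤ.* (b ℤ.* c ℤ.+ u) ℤ.+ v
  collect = solve-∀

coeff-+ : ∀ p q k → coeff (p + q) k ≡ coeff p k ℤ.+ coeff q k
coeff-+ []      q       k       = ≡.sym (ℤ.+-identityˡ (coeff q k))
coeff-+ (a ∷ p) []      k       = ≡.sym (ℤ.+-identityʳ (coeff (a ∷ p) k))
coeff-+ (a ∷ p) (b ∷ q) zero    = ≡.refl
coeff-+ (a ∷ p) (b ∷ q) (suc k) = coeff-+ p q k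

coeff-map : ∀ {φ : ℤ → ℤ} → φ 0ℤ ≡ 0ℤ → ∀ p k → coeff (map φ p) k ≡ φ (coeff p k)
coeff-map φ0 []      k       = ≡.sym φ0
coeff-map φ0 (a ∷ p) zero    = ≡.refl
coeff-map φ0 (a ∷ p) (suc k) = coeff-map φ0 p k

coeff-neg : ∀ p k → coeff (- p) k ≡ ℤ.- coeff p k
coeff-neg = coeff-map ≡.refl

coeff-* : ∀ p q k → coeff (p * q) k ≡ (coeff p ⋆ coeff q) k
coeff-* []      q k       = ≡.sym (⋆-zeroˡ (coeff q) k)
coeff-* (a ∷ p) q k       = ≡.trans
  (≡.trans
    (coeff-+ (map (a ℤ.*_) q) (0ℤ ∷ p * q) k)
    (cong (λ u → u ℤ.+ coeff (0ℤ ∷ p * q) k) (coeff-map (ℤ.*-zeroʳ a) q k)))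
  (tail k)
  where
  tail : ∀ k → a ℤ.* coeff q k ℤ.+ coeff (0ℤ ∷ p * q) k ≡ (coeff (a ∷ p) ⋆ coeff q) k
  tail zero    = ℤ.+-identityʳ (a ℤ.* coeff q 0)
  tail (suc k) = cong (λ u → a ℤ.* coeff q (suc k) ℤ.+ u) (coeff-* p q k)

-- Laws are transported along `coeff` from integer sequences. The operations are those of the
-- theorem, so determinants over this ring are definitionally the ones stated.
polyCommutativeRing : CommutativeRing 0ℓ 0ℓ
polyCommutativeRing = record
  { Carrier = Poly
  ; _≈_ = _≋_
  ; _+_ = _+_
  ; _*_ = _*_
  ; -_ = -_
  ; 0# = 0#
  ; 1# = 1#
  ; isCommutativeRing = record
    { isRing = record
      { +-isAbelianGroup = record
        { isGroup = record
          { isMonoid = record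
            { isSemigroup = record
              { isMagma = record
                { isEquivalence = record
                  { refl = coeffwise λ _ → ≡.refl
                  ; sym = λ (coeffwise p≡q) → coeffwise λ k → ≡.sym (p≡q k)
                  ; trans = λ (coeffwise p≡q) (coeffwise q≡r) → coeffwise λ k →
                      ≡.trans (p≡q k) (q≡r k)
                  }
                ; ∙-cong = λ {p} {p′} {q} {q′} (coeffwise p≡p′) (coeffwise q≡q′) →
                    coeffwise λ k → via (coeff-+ p q k) (coeff-+ p′ q′ k)
                      (cong₂ ℤ._+_ (p≡p′ k) (q≡q′ k))
                }
              ; assoc = λ p q r → coeffwise λ k → via
                  (≡.trans (coeff-+ (p + q) r k)
                    (cong (λ u → u ℤ.+ coeff r k) (coeff-+ p q k)))
                  (≡.trans (coeff-+ p (q + r) k)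
                    (cong (λ u → coeff p k ℤ.+ u) (coeff-+ q r k)))
                  (ℤ.+-assoc (coeff p k) (coeff q k) (coeff r k))
              }
            ; identity = (λ p → coeffwise λ _ → ≡.refl)
                , (λ p → coeffwise λ k → ≡.trans (coeff-+ p 0# k) (ℤ.+-identityʳ (coeff p k)))
            }
          ; inverse =
                (λ p → coeffwise λ k → via (coeff-+ (- p) p k)
                  (≡.sym (ℤ.+-inverseˡ (coeff p k)))
                  (cong (λ u → u ℤ.+ coeff p k) (coeff-neg p k)))
              , (λ p → coeffwise λ k → via (coeff-+ p (- p) k)
                  (≡.sym (ℤ.+-inverseʳ (coeff p k)))
                  (cong (λ u → coeff p k ℤ.+ u) (coeff-neg p k)))
          ; ⁻¹-cong = λ {p} {q} (coeffwise p≡q) → coeffwise λ k →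
              via (coeff-neg p k) (coeff-neg q k) (cong ℤ.-_ (p≡q k))
          }
        ; comm = λ p q → coeffwise λ k →
            via (coeff-+ p q k) (coeff-+ q p k) (ℤ.+-comm (coeff p k) (coeff q k))
        }
      ; *-cong = λ {p} {p′} {q} {q′} (coeffwise p≡p′) (coeffwise q≡q′) →
          coeffwise λ k → via (coeff-* p q k) (coeff-* p′ q′ k) (⋆-cong p≡p′ q≡q′ k)
      ; *-assoc = λ p q r → coeffwise λ k → via
          (≡.trans (coeff-* (p * q) r k) (⋆-cong (coeff-* p q) (λ _ → ≡.refl) k))
          (≡.trans (coeff-* p (q * r) k) (⋆-cong (λ _ → ≡.refl) (coeff-* q r) k))
          (⋆-assoc (coeff p) (coeff q) (coeff r) k)
      ; *-identity = *-identityˡ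
          , (λ p → coeffwise λ k → ≡.trans (*-comm p 1# k) (_≋_.coeff-≡ (*-identityˡ p) k))
      ; distrib =
            (λ p q r → coeffwise λ k → ≡.trans (*-comm p (q + r) k)
              (≡.trans (*-distribʳ p q r k) (via (coeff-+ (q * p) (r * p) k)
                (coeff-+ (p * q) (p * r) k)
                (cong₂ ℤ._+_ (*-comm q p k) (*-comm r p k)))))
          , (λ p q r → coeffwise (*-distribʳ p q r))
      }
    ; *-comm = λ p q → coeffwise (*-comm p q)
    }
  }
  where
  via : ∀ {a a′ b b′ : ℤ} → a ≡ a′ → b ≡ b′ → a′ ≡ b′ → a ≡ b
  via a≡a′ b≡b′ a′≡b′ = ≡.trans a≡a′ (≡.trans a′≡b′ (≡.sym b≡b′))

  *-comm : ∀ p q k → coeff (p * q) k ≡ coeff (q * p) k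
  *-comm p q k = via (coeff-* p q k) (coeff-* q p k) (⋆-comm (coeff p) (coeff q) k)

  *-distribʳ : ∀ p q r k → coeff ((q + r) * p) k ≡ coeff (q * p + r * p) k
  *-distribʳ p q r k = via
    (≡.trans (coeff-* (q + r) p k) (⋆-cong (coeff-+ q r) (λ _ → ≡.refl) k))
    (≡.trans (coeff-+ (q * p) (r * p) k) (cong₂ ℤ._+_ (coeff-* q p k) (coeff-* r p k)))
    (⋆-distribʳ (coeff q) (coeff r) (coeff p) k)

  *-identityˡ : ∀ p → 1# * p ≋ p
  *-identityˡ p = coeffwise λ where
    zero    → ≡.trans (coeff-* 1# p 0) (ℤ.*-identityˡ (coeff p 0))
    (suc k) → ≡.trans (coeff-* 1# p (suc k)) (≡.trans
      (cong₂ ℤ._+_ (ℤ.*-identityˡ (coeff p (suc k))) (⋆-zeroˡ (coeff p) k))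
      (ℤ.+-identityʳ (coeff p (suc k))))

-- The formal derivative.

coeff-scaleFrom : ∀ m p k → coeff (scaleFrom m p) k ≡ + (m ℕ.+ k) ℤ.* coeff p k
coeff-scaleFrom m []      k       = ≡.sym (ℤ.*-zeroʳ (+ (m ℕ.+ k)))
coeff-scaleFrom m (a ∷ p) zero    = cong (λ n → + n ℤ.* a) (≡.sym (ℕ.+-identityʳ m))
coeff-scaleFrom m (a ∷ p) (suc k) = ≡.trans (coeff-scaleFrom (suc m) p k)
  (cong (λ n → + n ℤ.* coeff p k) (≡.sym (ℕ.+-suc m k)))

coeff-deriv : ∀ p k → coeff (deriv p) k ≡ + suc k ℤ.* coeff p (suc k)
coeff-deriv []      k = ≡.sym (ℤ.*-zeroʳ (+ suc k))
coeff-deriv (_ ∷ p) k = coeff-scaleFrom 1 p k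

deriv-cong : p ≋ q → deriv p ≋ deriv q
deriv-cong {p} {q} (coeffwise p≡q) = coeffwise λ k → ≡.trans (coeff-deriv p k)
  (≡.trans (cong (+ suc k ℤ.*_) (p≡q (suc k))) (≡.sym (coeff-deriv q k)))

deriv-+ : ∀ p q → deriv (p + q) ≋ deriv p + deriv q
deriv-+ p q = coeffwise λ k → begin
  coeff (deriv (p + q)) k                                           ≡⟨ coeff-deriv (p + q) k ⟩
  + suc k ℤ.* coeff (p + q) (suc k)                                 ≡⟨ cong (+ suc k ℤ.*_) (coeff-+ p q (suc k)) ⟩
  + suc k ℤ.* (coeff p (suc k) ℤ.+ coeff q (suc k))                 ≡⟨ ℤ.*-distribˡ-+ (+ suc k) (coeff p (suc k)) (coeff q (suc k)) ⟩
  + suc k ℤ.* coeff p (suc k) ℤ.+ + suc k ℤ.* coeff q (suc k)       ≡⟨ cong₂ ℤ._+_ (coeff-deriv p k) (coeff-deriv q k) ⟨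
  coeff (deriv p) k ℤ.+ coeff (deriv q) k                           ≡⟨ coeff-+ (deriv p) (deriv q) k ⟨
  coeff (deriv p + deriv q) k                                       ∎
  where open ≡.≡-Reasoning

coeff-x*-zero : ∀ p → coeff (x * p) 0 ≡ 0ℤ
coeff-x*-zero p = coeff-* x p 0

coeff-x*-suc : ∀ p k → coeff (x * p) (suc k) ≡ coeff p k
coeff-x*-suc p k = begin
  coeff (x * p) (suc k)              ≡⟨ coeff-* x p (suc k) ⟩
  0ℤ ℤ.+ (coeff 1# ⋆ coeff p) k      ≡⟨ ℤ.+-identityˡ _ ⟩
  (coeff 1# ⋆ coeff p) k             ≡⟨ coeff-* 1# p k ⟨
  coeff (1# * p) k                   ≡⟨ _≋_.coeff-≡ (*-identityˡ p) k ⟩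
  coeff p k                          ∎
  where
  open ≡.≡-Reasoning
  open CommutativeRing polyCommutativeRing using (*-identityˡ)

deriv-x* : ∀ p → deriv (x * p) ≋ p + x * deriv p
deriv-x* p = coeffwise λ k → begin
  coeff (deriv (x * p)) k                      ≡⟨ coeff-deriv (x * p) k ⟩
  + suc k ℤ.* coeff (x * p) (suc k)            ≡⟨ cong (+ suc k ℤ.*_) (coeff-x*-suc p k) ⟩
  + suc k ℤ.* coeff p k                        ≡⟨ ℤ.suc-* (+ k) (coeff p k) ⟩
  coeff p k ℤ.+ + k ℤ.* coeff p k              ≡⟨ cong (λ u → coeff p k ℤ.+ u) (shift k) ⟨
  coeff p k ℤ.+ coeff (x * deriv p) k          ≡⟨ coeff-+ p (x * deriv p) k ⟨
  coeff (p + x * deriv p) k                    ∎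
  where
  open ≡.≡-Reasoning
  shift : ∀ k → coeff (x * deriv p) k ≡ + k ℤ.* coeff p k
  shift zero    = coeff-x*-zero (deriv p)
  shift (suc k) = ≡.trans (coeff-x*-suc (deriv p) k) (coeff-deriv p k)

-- Multiplication by 1 - x.

private
  y : Poly
  y = 1# + - x

x+y≋1 : x + y ≋ 1#
x+y≋1 = coeffwise λ where
  0             → ≡.refl
  1             → ≡.refl
  (suc (suc k)) → ≡.refl

y*+x* : ∀ p → y * p + x * p ≋ p
y*+x* p = begin
  y * p + x * p  ≈⟨ distribʳ p y x ⟨
  (y + x) * p    ≈⟨ *-congʳ (trans (+-comm y x) x+y≋1) ⟩
  1# * p         ≈⟨ *-identityˡ p ⟩
  p              ∎
  where
  open CommutativeRing polyCommutativeRing hiding (_+_; _*_; 1#)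
  open import Relation.Binary.Reasoning.Setoid setoid

-- Since y p + x p = p, additivity and the rule for `x * p` determine the derivative of `y * p`; no
-- general product rule enters.
deriv-y* : ∀ p → deriv (y * p) + p ≋ y * deriv p
deriv-y* p = +-cancelʳ (x * deriv p) _ _ (begin
  deriv (y * p) + p + x * deriv p      ≈⟨ +-assoc (deriv (y * p)) p (x * deriv p) ⟩
  deriv (y * p) + (p + x * deriv p)    ≈⟨ +-congˡ (deriv-x* p) ⟨
  deriv (y * p) + deriv (x * p)        ≈⟨ deriv-+ (y * p) (x * p) ⟨
  deriv (y * p + x * p)                ≈⟨ deriv-cong (y*+x* p) ⟩
  deriv p                              ≈⟨ y*+x* (deriv p) ⟨
  y * deriv p + x * deriv p            ∎)
  where
  open CommutativeRing polyCommutativeRing hiding (_+_; _*_)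
  open import Algebra.Properties.Group +-group renaming (∙-cancelʳ to +-cancelʳ)
  open import Relation.Binary.Reasoning.Setoid setoid

-- As p = y p + x p, coefficient k of p is determined by that of `y * p` and by coefficient k - 1 of
-- p, so induction on k applies.
y*-cancelˡ : ∀ p q → y * p ≋ y * q → p ≋ q
y*-cancelˡ p q (coeffwise yp≡yq) = coeffwise equal
  where
  open ≡.≡-Reasoning
  split : ∀ p k → coeff (y * p) k ℤ.+ coeff (x * p) k ≡ coeff p k
  split p k = ≡.trans (≡.sym (coeff-+ (y * p) (x * p) k)) (_≋_.coeff-≡ (y*+x* p) k)

  lift : ∀ k → coeff (x * p) k ≡ coeff (x * q) k → coeff p k ≡ coeff q k
  lift k xp≡xq = ≡.trans (≡.sym (split p k)) (≡.trans (cong₂ ℤ._+_ (yp≡yq k) xp≡xq) (split q k))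

  equal : ∀ k → coeff p k ≡ coeff q k
  equal zero    = lift 0 (≡.trans (coeff-x*-zero p) (≡.sym (coeff-x*-zero q)))
  equal (suc k) = lift (suc k)
    (≡.trans (coeff-x*-suc p k) (≡.trans (equal k) (≡.sym (coeff-x*-suc q k))))

-- Application to the two matrices.

private
  -- Row i and column j + 1 counted from 0 are row i + 1 and column j + 2 counted from 1.
  entry : ℕ → ℕ → Poly
  entry i j = hessenbergEntry (suc i) (suc (suc j))

open HessenbergDeterminant polyCommutativeRing using (IsHessenberg; hess; det-cong)
open BinomialTransform polyCommutativeRing y using (transform)
open PivotElimination.ByTransform polyCommutativeRing x y x+y≋1 y*-cancelˡ using (hess-det-transform)
open EulerianRecurrences.FromDerivation polyCommutativeRing x y x+y≋1 deriv deriv-cong deriv-+ deriv-x* deriv-y*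
  A (coeffwise λ _ → ≡.refl) (coeffwise λ _ → ≡.refl) (λ _ → coeffwise λ _ → ≡.refl)
  using (δA-pivots; δA⁻; δA⁻-pivots)

entry-isHessenberg : IsHessenberg entry
entry-isHessenberg = record { superdiagonal = superdiagonal ; above = above }
  where
  open CommutativeRing polyCommutativeRing using (refl)

  -- The decision procedures compute to the Boolean tests of `hessenbergEntry`, so deciding them
  -- selects its branch.
  superdiagonal : ∀ i → entry i i ≋ - 1#
  superdiagonal i
    rewrite dec-false (suc i ℕ.<? suc i) (ℕ.<-irrefl ≡.refl) | dec-true (i ℕ.≟ i) ≡.refl = refl

  above : ∀ {i j} → i < j → entry i j ≋ 0#
  above {i} {j} i<j
    rewrite dec-false (suc j ℕ.<? suc i) (ℕ.<-asym (s≤s i<j)) | dec-false (j ℕ.≟ i) (ℕ.>⇒≢ i<j) = refl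

entry-below : ∀ {i j} → j < i → entry i j ≋ ((suc i C suc j) · x) * y ^ (i ∸ suc j)
entry-below {i} {j} j<i rewrite dec-true (suc j ℕ.<? suc i) (s≤s j<i) = refl
  where open CommutativeRing polyCommutativeRing using (refl)

hessenberg-det : ∀ firstColumn D → D 0 ≋ 0# →
  (∀ i → D (suc i) ≋ y * firstColumn (suc i) + x * transform (suc i) D) →
  ∀ m → D (suc m) ≋ det (hessenberg (suc m) firstColumn)
hessenberg-det firstColumn D D0≋0 pivots m = sym (trans
  (det-cong (hessenberg (suc m) firstColumn) (hess (suc m) entry (firstColumn ∘ suc)) λ where
    r zero    → refl
    r (suc s) → refl)
  (hess-det-transform entry-below D0≋0 entry-isHessenberg pivots m))
  where open CommutativeRing polyCommutativeRing using (refl; sym; trans)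

corollary2p3 : (n : ℕ) → 2 ≤ n →
    (deriv (A n) ≈ det (hessenberg n firstColumn₁)) ×
    (deriv (A (n ∸ 1)) ≈ det (hessenberg n firstColumn₂))
corollary2p3 (suc (suc n)) (s≤s (s≤s z≤n)) =
    hessenberg-det firstColumn₁ (deriv ∘ A) (coeffwise λ _ → ≡.refl) pivots₁ (suc n)
  -- The last pivot has index n + 2, and `δA⁻` at that index is `deriv (A (suc n))`.
  , hessenberg-det firstColumn₂ δA⁻ (coeffwise λ _ → ≡.refl) pivots₂ (suc n)
  where
  -- Splitting on the row lets the first column of the theorem reduce to `column₁`.
  pivots₁ : ∀ i → deriv (A (suc i)) ≋ y * firstColumn₁ (suc i) + x * transform (suc i) (deriv ∘ A)
  pivots₁ zero    = δA-pivots zero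
  pivots₁ (suc i) = δA-pivots (suc i)

  pivots₂ : ∀ i → δA⁻ (suc i) ≋ y * firstColumn₂ (suc i) + x * transform (suc i) δA⁻
  pivots₂ zero    = δA⁻-pivots zero
  pivots₂ (suc i) = δA⁻-pivots (suc i)
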